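{- Let $G=(V,E)$ be an undirected graph that is a pseudo-clique of size $n\ge 3$ and cardinality $k\ge 0$. Then the tree width of $G$ is $n-1$.
   Context: An undirected graph $G=(V,E)$ is a pseudo-clique if $V$ can be partitioned into a set $V_{\mathit{main}}$ of main-nodes and, for each pair $u\neq v$ of main-nodes, a set $V_{u,v}$ of edge-nodes, such that for each such pair, writing $V_{u,v}=\{v_1,\dots,v_m\}$, the edges $(u,v_1),(v_1,v_2),\dots,(v_{m-1},v_m),(v_m,v)$ are present (so $u,v_1,\dots,v_m,v$ is a simple path from $u$ to $v$), and no other edges are present. The size of the pseudo-clique is $|V_{\mathit{main}}|$, and its cardinality is $\max_{u\neq v\in V_{\mathit{main}}}|V_{u,v}|$. -}

module Defs where

open import Level using (0ℓ)
open import Data.Fin using (Fin)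
open import Data.Fin.Subset using (Subset; _∈_; _∉_; ∣_∣)
open import Data.List using (List; []; _∷_; _∷ʳ_; length; reverse; map; allFin)
open import Data.List.Extrema.Nat using (max)
import Data.List.Membership.Propositional as List
open import Data.List.Relation.Binary.Infix.Heterogeneous using (Infix)
open import Data.List.Relation.Unary.Linked using (Linked)
open import Data.List.Relation.Unary.Unique.Propositional using (Unique)
open import Data.Nat using (ℕ; _∸_; _≤_; NonZero)
open import Data.Product using (∃; ∃₂; _×_)
open import Data.Sum using (_⊎_)
open import Function.Bundles using (_⇔_)
open import Relation.Binary.Construct.Closure.ReflexiveTransitive using (Star)
open import Relation.Binary.Core using (Rel)
open import Relation.Binary.Definitions using (Decidable; Irreflexive; Symmetric)
open import Relation.Binary.PropositionalEquality using (_≡_; _≢_)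
open import Relation.Nullary using (¬_)

record Graph (N : ℕ) : Set₁ where
  field
    Adj    : Rel (Fin N) 0ℓ
    sym    : Symmetric Adj
    irrefl : Irreflexive _≡_ Adj
    adj?   : Decidable Adj

module _ {N : ℕ} (G : Graph N) where
  open Graph G

  Connected : Set
  Connected = ∀ x y → Star Adj x y

  -- The subgraph induced by P is connected: all vertices visited lie in P.
  ConnectedOn : (Fin N → Set) → Set
  ConnectedOn P = ∀ {x y} → P x → P y → Star (λ a b → P a × P b × Adj a b) x y

  -- The vertices of a cycle are listed without repetition; there are at
  -- least three of them, and the last is adjacent to the first.
  Acyclic : Set
  Acyclic = ∀ x xs → Unique (x ∷ xs) → 2 ≤ length xs → ¬ Linked Adj (x ∷ xs ∷ʳ x)

  record IsTree : Set where
    field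
      nonEmpty  : NonZero N
      connected : Connected
      acyclic   : Acyclic

record TreeDecomposition {N : ℕ} (G : Graph N) : Set₁ where
  open Graph G
  field
    {nodes}     : ℕ
    tree        : Graph nodes
    isTree      : IsTree tree
    bag         : Fin nodes → Subset N
    coverVertex : ∀ x → ∃ λ i → x ∈ bag i
    coverEdge   : ∀ {x y} → Adj x y → ∃ λ i → x ∈ bag i × y ∈ bag i
    coherent    : ∀ x → ConnectedOn tree (λ i → x ∈ bag i)

-- As soon as N is positive some bag is nonempty, so the subtraction
-- truncates only for the graph without vertices.
width : ∀ {N} {G : Graph N} → TreeDecomposition G → ℕ
width D = max 0 (map (λ i → ∣ bag i ∣) (allFin nodes)) ∸ 1
  where open TreeDecomposition D

record IsTreewidth {N : ℕ} (G : Graph N) (w : ℕ) : Set₁ where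
  field
    attained : ∃ λ (D : TreeDecomposition G) → width D ≡ w
    minimal  : ∀ (D : TreeDecomposition G) → w ≤ width D

Consecutive : ∀ {A : Set} → A → A → List A → Set
Consecutive x y xs = Infix _≡_ (x ∷ y ∷ []) xs

record PseudoClique {N : ℕ} (G : Graph N) : Set where
  open Graph G
  field
    main      : Subset N
    -- edgeNodes u v lists V_{u,v} in the order met on the path from u to v.
    -- It is meaningful only for distinct main-nodes u and v.
    edgeNodes : Fin N → Fin N → List (Fin N)

  MainPair : Fin N → Fin N → Set
  MainPair u v = u ∈ main × v ∈ main × u ≢ v

  path : Fin N → Fin N → List (Fin N)
  path u v = u ∷ edgeNodes u v ∷ʳ v

  field
    -- Pairs are unordered: (u , v) and (v , u) name the same set and path.
    unordered : ∀ {u v} → MainPair u v → edgeNodes v u ≡ reverse (edgeNodes u v)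
    unique    : ∀ {u v} → MainPair u v → Unique (edgeNodes u v)

    cover     : ∀ x → x ∈ main ⊎ (∃₂ λ u v → MainPair u v × x List.∈ edgeNodes u v)
    notMain   : ∀ {u v x} → MainPair u v → x List.∈ edgeNodes u v → x ∉ main
    disjoint  : ∀ {u v u′ v′ x} → MainPair u v → MainPair u′ v′ →
                x List.∈ edgeNodes u v → x List.∈ edgeNodes u′ v′ →
                (u ≡ u′ × v ≡ v′) ⊎ (u ≡ v′ × v ≡ u′)

    edges     : ∀ x y → Adj x y ⇔ (∃₂ λ u v → MainPair u v × Consecutive x y (path u v))

  size : ℕ
  size = ∣ main ∣

  record IsCardinality (k : ℕ) : Set where
    field
      bound    : ∀ {u v} → MainPair u v → length (edgeNodes u v) ≤ k
      attained : ∃₂ λ u v → MainPair u v × length (edgeNodes u v) ≡ k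

{-# OPTIONS --safe #-}

-- Lower bound.  Give every edge-node of V_{u,v} to the smaller of u and v.  The
-- branches so obtained are disjoint, connected and pairwise adjacent, so in a tree
-- decomposition their traces are pairwise intersecting subtrees.  Such subtrees have
-- a common node (Helly); its bag meets all n branches and thus has at least n elements.
--
-- Upper bound.  Hang on a central bag V_main, for each pair u < v, a chain of bags
-- of size at most 3 ≤ n that runs along the path from u to v and keeps v throughout.

module Submission where

open import Defs
open import Data.Fin as Fin using (Fin; zero; suc; inject₁; fromℕ; toℕ)
import Data.Fin.Properties as Fin
open import Data.Fin.Induction using (<-weakInduction)
open import Data.Fin.Subset using (Subset; inside; outside; ⊥; ⁅_⁆; _∪_; _∈_; _∉_; _⊆_; ∣_∣)
open import Data.Fin.Subset.Properties
  using (_∈?_; ∉⊥; x∈⁅x⁆; x∈⁅y⁆⇒x≡y; ∣⁅x⁆∣≡1; ∣⊥∣≡0; x∈p∪q⁺; x∈p∪q⁻; p⊆q⇒∣p∣≤∣q∣)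
open import Data.List using (List; []; _∷_; _∷ʳ_; _++_; _ʳ++_; length; lookup; reverse; map; allFin)
open import Data.List.Extrema.Nat using (max≤v⁺; xs≤max)
open import Data.List.Membership.Propositional using () renaming (_∈_ to _∈ˡ_; _∉_ to _∉ˡ_)
open import Data.List.Membership.Propositional.Properties using (∈-∃++; ∈-lookup; ∈-allFin; ∈-map⁺)
open import Data.List.Properties using (reverse-++; unfold-reverse; ʳ++-defn)
open import Data.List.Relation.Binary.Infix.Heterogeneous using (here; there; _++ⁱ_)
import Data.List.Relation.Binary.Prefix.Heterogeneous as Prefix
open import Data.List.Relation.Unary.All as All using (All; []; _∷_)
import Data.List.Relation.Unary.All.Properties as All
open import Data.List.Relation.Unary.AllPairs using ([]; _∷_)
open import Data.List.Relation.Unary.Any as Any using (here; there)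
import Data.List.Relation.Unary.Any.Properties as Any
open import Data.List.Relation.Unary.Linked using (Linked; [-]; _∷_)
open import Data.List.Relation.Unary.Unique.Propositional using (Unique)
open import Data.List.Relation.Unary.Unique.Propositional.Properties using (Unique[x∷xs]⇒x∉xs)
open import Data.Maybe as Maybe using (Maybe; just; nothing; maybe)
open import Data.Nat as ℕ using (ℕ; zero; suc; _+_; _∸_; _≤_; _<_; _≥_; z≤n; s≤s)
import Data.Nat.Properties as ℕ
open import Data.Nat.Induction using (<-wellFounded)
open import Data.Product using (∃; ∃₂; _×_; _,_; proj₁; proj₂; map₂)
open import Data.Sum as Sum using (_⊎_; inj₁; inj₂)
open import Data.Unit using (⊤; tt)
open import Data.Vec.Base as Vec using ([]; _∷_)
open import Function using (_∘_; id)
open import Function.Bundles using (Equivalence)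
open import Induction.WellFounded using (Acc; acc)
open import Relation.Binary.Construct.Closure.ReflexiveTransitive as Star using (Star; ε; _◅_; _◅◅_)
open import Relation.Binary.Definitions using (tri<; tri≈; tri>)
open import Relation.Binary.PropositionalEquality
  using (_≡_; _≢_; refl; sym; trans; cong; subst)
open import Relation.Nullary using (¬_; Dec; yes; no; contradiction)
open import Relation.Nullary.Decidable using (_⊎-dec_)

-- Cardinalities of finite sets, and lists without repetition

∣p∪q∣≤∣p∣+∣q∣ : ∀ {n} (p q : Subset n) → ∣ p ∪ q ∣ ≤ ∣ p ∣ + ∣ q ∣
∣p∪q∣≤∣p∣+∣q∣ []            []            = z≤n
∣p∪q∣≤∣p∣+∣q∣ (outside ∷ p) (outside ∷ q) = ∣p∪q∣≤∣p∣+∣q∣ p q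
∣p∪q∣≤∣p∣+∣q∣ (inside ∷ p)  (outside ∷ q) = s≤s (∣p∪q∣≤∣p∣+∣q∣ p q)
∣p∪q∣≤∣p∣+∣q∣ (outside ∷ p) (inside ∷ q)  =
  ℕ.≤-trans (s≤s (∣p∪q∣≤∣p∣+∣q∣ p q)) (ℕ.≤-reflexive (sym (ℕ.+-suc ∣ p ∣ ∣ q ∣)))
∣p∪q∣≤∣p∣+∣q∣ (inside ∷ p)  (inside ∷ q)  =
  s≤s (ℕ.≤-trans (∣p∪q∣≤∣p∣+∣q∣ p q) (ℕ.+-monoʳ-≤ ∣ p ∣ (ℕ.n≤1+n ∣ q ∣)))

image : ∀ {m n} → (Fin m → Fin n) → Subset m → Subset n
image f []            = ⊥
image f (outside ∷ q) = image (f ∘ suc) q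
image f (inside ∷ q)  = ⁅ f zero ⁆ ∪ image (f ∘ suc) q

∈-image : ∀ {m n} (f : Fin m → Fin n) {q x} → x ∈ q → f x ∈ image f q
∈-image f {inside ∷ q}  Vec.here        = x∈p∪q⁺ (inj₁ (x∈⁅x⁆ (f zero)))
∈-image f {inside ∷ q}  (Vec.there x∈q) = x∈p∪q⁺ (inj₂ (∈-image (f ∘ suc) x∈q))
∈-image f {outside ∷ q} (Vec.there x∈q) = ∈-image (f ∘ suc) x∈q

∣image∣≤ : ∀ {m n} (f : Fin m → Fin n) q → ∣ image f q ∣ ≤ ∣ q ∣
∣image∣≤ {n = n} f []   = ℕ.≤-reflexive (∣⊥∣≡0 n)
∣image∣≤ f (outside ∷ q) = ∣image∣≤ (f ∘ suc) q
∣image∣≤ f (inside ∷ q)  = ℕ.≤-trans (∣p∪q∣≤∣p∣+∣q∣ ⁅ f zero ⁆ _)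
  (ℕ.+-mono-≤ (ℕ.≤-reflexive (∣⁅x⁆∣≡1 (f zero))) (∣image∣≤ (f ∘ suc) q))

Unique⇒lookup-injective : ∀ {A : Set} {xs : List A} → Unique xs →
  ∀ i j → lookup xs i ≡ lookup xs j → i ≡ j
Unique⇒lookup-injective (_ ∷ _)    zero    zero    _  = refl
Unique⇒lookup-injective (x∉ ∷ _)   zero    (suc j) eq = contradiction eq (All.lookup x∉ (∈-lookup j))
Unique⇒lookup-injective (x∉ ∷ _)   (suc i) zero    eq = contradiction (sym eq) (All.lookup x∉ (∈-lookup i))
Unique⇒lookup-injective (_ ∷ uniq) (suc i) (suc j) eq = cong suc (Unique⇒lookup-injective uniq i j eq)

unique-prefix : ∀ {A : Set} (as : List A) {bs} → Unique (as ++ bs) → Unique as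
unique-prefix []       _        = []
unique-prefix (_ ∷ as) (p ∷ ps) = All.++⁻ˡ as p ∷ unique-prefix as ps

unique-split : ∀ {A : Set} {x : A} as {bs} → Unique (as ++ x ∷ bs) → x ∉ˡ as
unique-split (_ ∷ as) (a∉ ∷ _) (here refl) = All.lookup a∉ (Any.++⁺ʳ as (here refl)) refl
unique-split (_ ∷ as) (_ ∷ u)  (there x∈)  = unique-split as u x∈

-- Consecutive entries of a list

module _ {A : Set} where

  -- The accumulator `zs` is what the induction needs; reversal is the case `zs = []`.
  consecutive-ʳ++ : ∀ {x y : A} {xs} zs → Consecutive x y xs → Consecutive y x (xs ʳ++ zs)
  consecutive-ʳ++ {x} {y} zs (here {bs = _ ∷ _ ∷ bs} (refl Prefix.∷ refl Prefix.∷ _)) =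
    subst (Consecutive y x) (sym (ʳ++-defn bs)) (reverse bs ++ⁱ here (refl Prefix.∷ refl Prefix.∷ Prefix.[]))
  consecutive-ʳ++ zs (there {b = b} c) = consecutive-ʳ++ (b ∷ zs) c

  consecutive-inner : ∀ {u v : A} ys (i : Fin (length ys)) →
    Consecutive (lookup (u ∷ ys) (inject₁ i)) (lookup ys i) (u ∷ ys ∷ʳ v)
  consecutive-inner (y ∷ ys) zero    = here (refl Prefix.∷ refl Prefix.∷ Prefix.[])
  consecutive-inner (y ∷ ys) (suc i) = there (consecutive-inner ys i)

  consecutive-last : ∀ {u v : A} ys →
    Consecutive (lookup (u ∷ ys) (fromℕ (length ys))) v (u ∷ ys ∷ʳ v)
  consecutive-last []       = here (refl Prefix.∷ refl Prefix.∷ Prefix.[])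
  consecutive-last (y ∷ ys) = there (consecutive-last ys)

  consecutive⁻ : ∀ {x y u v : A} ys → Consecutive x y (u ∷ ys ∷ʳ v) →
    (∃ λ i → x ≡ lookup (u ∷ ys) (inject₁ i) × y ≡ lookup ys i) ⊎
    (∃ λ i → x ≡ lookup (u ∷ ys) i × y ≡ v)
  consecutive⁻ []       (here (x≡u Prefix.∷ y≡v Prefix.∷ _)) = inj₂ (zero , x≡u , y≡v)
  consecutive⁻ []       (there (here (_ Prefix.∷ ())))
  consecutive⁻ []       (there (there (here ())))
  consecutive⁻ (_ ∷ ys) (here (x≡u Prefix.∷ y≡v Prefix.∷ _)) = inj₁ (zero , x≡u , y≡v)
  consecutive⁻ (_ ∷ ys) (there c) with consecutive⁻ ys c
  ... | inj₁ (i , x≡ , y≡) = inj₁ (suc i , x≡ , y≡)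
  ... | inj₂ (i , x≡ , y≡) = inj₂ (suc i , x≡ , y≡)

-- Walks without backtracking, and the Helly property of subtrees

module Walks {n} (T : Graph n) where
  open Graph T renaming (sym to adj-sym)

  -- Forbids an immediate return in a walk. This local condition is easy to maintain under
  -- induction, and in an acyclic graph it already excludes every repetition (`walk-unique`).
  HeadNot : Fin n → List (Fin n) → Set
  HeadNot x []      = ⊤
  HeadNot x (y ∷ _) = x ≢ y

  -- The list omits the first vertex of the walk and includes the last one.
  data Walk (x : Fin n) : List (Fin n) → Fin n → Set where
    nil  : Walk x [] x
    cons : ∀ {y p z} → Adj x y → HeadNot x p → Walk y p z → Walk x (y ∷ p) z

  -- The condition under which the reverse of one walk can be continued by the other without
  -- backtracking at their common start.
  Diverge : List (Fin n) → List (Fin n) → Set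
  Diverge []      q = ⊤
  Diverge (x ∷ _) q = HeadNot x q

  end∈ : ∀ {x p y} → Walk x p y → y ∈ˡ x ∷ p
  end∈ nil          = here refl
  end∈ (cons _ _ w) = there (end∈ w)

  adj⇒≢ : ∀ {x y} → Adj x y → x ≢ y
  adj⇒≢ xy x≡y = irrefl x≡y xy

  -- Step by step, the start of the first walk moves forward and the reversed step is put in front
  -- of the second walk. The inclusion shows that the result still visits the common start.
  join : ∀ {x p q a b} → Walk x p a → Walk x q b → Diverge p q →
    ∃ λ r → Walk a r b × (∀ {z} → z ∈ˡ x ∷ q → z ∈ˡ a ∷ r)
  join nil w _ = _ , w , id
  join {x} {q = q} (cons {p = p} xy x≢p w) w′ div
    with join w (cons (adj-sym xy) div w′) (diverge p x≢p)
    where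
    diverge : ∀ p → HeadNot x p → Diverge p (x ∷ q)
    diverge []      _   = tt
    diverge (_ ∷ _) x≢p = x≢p ∘ sym
  ... | r , w″ , inc = r , w″ , inc ∘ there

  -- Prepending a step to a walk either extends it or cancels its first step.
  reduce : ∀ {P : Fin n → Set} {x y} → Star (λ a b → P a × P b × Adj a b) x y →
    ∃ λ p → Walk x p y × All P p
  reduce ε = [] , nil , []
  reduce {x = x} ((Px , Py , xy) ◅ s) with reduce s
  ... | []    , w , ps = _ , cons xy tt w , Py ∷ ps
  ... | z ∷ p , w@(cons _ _ w′) , ps@(_ ∷ ps′) with x Fin.≟ z
  ...   | yes refl = p , w′ , ps′
  ...   | no x≢z   = _ , cons xy x≢z w , Py ∷ ps

  linked-prefix : ∀ {x z y} as {bs} → Walk x (as ++ z ∷ bs) y → Linked Adj (x ∷ as ∷ʳ z)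
  linked-prefix []       (cons xz _ _) = xz ∷ [-]
  linked-prefix (_ ∷ as) (cons xa _ w) = xa ∷ linked-prefix as w

  module _ (acyclic : Acyclic T) where

    -- The tail has no repetition by induction, so only a return to `x` is to be excluded. With no
    -- vertex in between it would be a loop, with one it would be backtracking, and with more it
    -- would be a cycle.
    walk-unique : ∀ {x p y} → Walk x p y → Unique (x ∷ p)
    walk-unique nil = [] ∷ []
    walk-unique {x} {p} w@(cons _ _ w′) = All.¬Any⇒All¬ p x∉p ∷ uniq
      where
      uniq : Unique p
      uniq = walk-unique w′
      no-return : ∀ as bs → p ≡ as ++ x ∷ bs → x ∉ˡ as → ∀ {y} → ¬ Walk x p y
      no-return []           bs refl x∉ (cons xx _ _)   = irrefl refl xx
      no-return (_ ∷ [])     bs refl x∉ (cons _ x≢x _) = x≢x refl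
      no-return as@(_ ∷ _ ∷ _) bs refl x∉ w =
        acyclic x as (All.¬Any⇒All¬ as x∉ ∷ unique-prefix as uniq) (s≤s (s≤s z≤n)) (linked-prefix as w)
      x∉p : x ∉ˡ p
      x∉p x∈p with ∈-∃++ x∈p
      ... | as , bs , eq = no-return as bs eq (unique-split as (subst Unique eq uniq)) w

    closed-trivial : ∀ {x p} → Walk x p x → p ≡ []
    closed-trivial nil              = refl
    closed-trivial w@(cons _ _ w′) = contradiction (end∈ w′) (Unique[x∷xs]⇒x∉xs (walk-unique w))

    -- Joining the two walks gives a closed walk at `y`, which is trivial. So the adjacent vertices
    -- `x` and `b`, which it visits, would both be `y`.
    no-diverging : ∀ {x a b p q y} → Walk x (a ∷ p) y → Walk x (b ∷ q) y → ¬ a ≢ b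
    no-diverging w@(cons _ _ _) w′@(cons xb _ _) a≢b with join w w′ a≢b
    ... | r , w″ , inc with closed-trivial w″
    ...   | refl with inc (here refl) | inc (there (here refl))
    ...     | here x≡y | here b≡y = adj⇒≢ xb (trans x≡y (sym b≡y))

    walk-determined : ∀ {x p q y} → Walk x p y → Walk x q y → p ≡ q
    walk-determined nil w = sym (closed-trivial w)
    walk-determined w@(cons _ _ _) nil = closed-trivial w
    walk-determined w@(cons {y = a} _ _ w₁) w′@(cons {y = b} _ _ w₂) with a Fin.≟ b
    ... | yes refl = cong (a ∷_) (walk-determined w₁ w₂)
    ... | no a≢b   = contradiction a≢b (no-diverging w w′)

    -- Connectedness in terms of walks. In this form it passes to intersections pointwise, as the
    -- induction in `helly` requires.
    Convex : (Fin n → Set) → Set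
    Convex P = ∀ {x p y} → Walk x p y → P x → P y → All P (x ∷ p)

    -- Cancelling the backtracking of a connection inside `P` leaves a walk inside `P`, and there is
    -- only one walk between its ends.
    connected⇒convex : ∀ {P} → ConnectedOn T P → Convex P
    connected⇒convex conn w Px Py with reduce (conn Px Py)
    ... | _ , w′ , ps rewrite walk-determined w w′ = Px ∷ ps

    _⊓_ : (Fin n → Set) → (Fin n → Set) → Fin n → Set
    (P ⊓ Q) x = P x × Q x

    ⊓-convex : ∀ {P Q} → Convex P → Convex Q → Convex (P ⊓ Q)
    ⊓-convex cP cQ w (Px , Qx) (Py , Qy) = All.zip (cP w Px Py , cQ w Qx Qy)

    -- The median: follow the walks from a to b and from a to c as long as
    -- they agree; where they part they form a walk from b to c.
    helly₃ : ∀ {P Q R} → Convex P → Convex Q → Convex R →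
      ∀ {a b c p q} → Walk a p b → Walk a q c →
      Q a × R a → P b × R b → P c × Q c → ∃ λ m → P m × Q m × R m
    helly₃ cP cQ cR nil _ (Qa , Ra) (Pb , _) _ = _ , Pb , Qa , Ra
    helly₃ cP cQ cR (cons _ _ _) nil (Qa , Ra) _ (Pc , _) = _ , Pc , Qa , Ra
    helly₃ cP cQ cR w₁@(cons {y = x} _ _ w₁′) w₂@(cons {y = y} _ _ w₂′) (Qa , Ra) (Pb , Rb) (Pc , Qc)
      with x Fin.≟ y
    ... | yes refl = helly₃ cP cQ cR w₁′ w₂′
          (All.head (All.tail (cQ w₂ Qa Qc)) , All.head (All.tail (cR w₁ Ra Rb))) (Pb , Rb) (Pc , Qc)
    ... | no x≢y with join w₁ w₂ x≢y
    ...   | _ , w , inc = _ , All.lookup (cP w Pb Pc) (inc (here refl)) , Qa , Ra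

    module _ (connected : Connected T) where

      walk : ∀ x y → ∃ λ p → Walk x p y
      walk x y with reduce {P = λ _ → ⊤} (Star.map (λ xy → tt , tt , xy) (connected x y))
      ... | p , w , _ = p , w

      -- Induction on the list: intersect the whole family with `P j`. The new sets are convex and
      -- still meet pairwise, by the case of three sets. The separate index `i` keeps the family
      -- nonempty when the list runs out.
      helly : ∀ {I : Set} (P : I → Fin n → Set) → (∀ i → Convex (P i)) →
        (∀ i j → ∃ (P i ⊓ P j)) → ∀ i js → ∃ λ t → P i t × All (λ j → P j t) js
      helly P cP meet i [] with meet i i
      ... | t , Pt , _ = t , Pt , []
      helly P cP meet i (j ∷ js)
        with helly (λ k → P j ⊓ P k) (λ k → ⊓-convex (cP j) (cP k)) meet₃ i js
        where
        meet₃ : ∀ k l → ∃ ((P j ⊓ P k) ⊓ (P j ⊓ P l))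
        meet₃ k l with meet k l | meet j l | meet j k
        ... | a , Pa | b , Pb | c , Pc
          with helly₃ (cP j) (cP k) (cP l) (proj₂ (walk a b)) (proj₂ (walk a c)) Pa Pb Pc
        ...   | m , Pj , Pk , Pl = m , (Pj , Pk) , (Pj , Pl)
      ... | t , (Pj , Pi) , ps = t , Pi , Pj ∷ All.map proj₂ ps

  -- A cycle through `x` with its first edge removed. Distinctness of its vertices is what rules out
  -- backtracking.
  cycle⇒walk : ∀ {y x} ys → Linked Adj (y ∷ ys ∷ʳ x) → Unique (y ∷ ys) → x ∉ˡ y ∷ ys →
    Walk y (ys ∷ʳ x) x
  cycle⇒walk []           (yx ∷ [-]) _ _ = cons yx tt nil
  cycle⇒walk (z ∷ [])     (yz ∷ l) (_ ∷ u) x∉ =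
    cons yz (λ y≡x → x∉ (here (sym y≡x))) (cycle⇒walk [] l u (x∉ ∘ there))
  cycle⇒walk (z ∷ z′ ∷ zs) (yz ∷ l) ((_ ∷ y≢z′ ∷ _) ∷ u) x∉ =
    cons yz y≢z′ (cycle⇒walk (z′ ∷ zs) l u (x∉ ∘ there))

-- Trees given by a parent function

module Rooted {N} (parent : Fin N → Fin (suc N)) (depth : Fin (suc N) → ℕ)
              (parent-depth : ∀ x → depth (parent x) < depth (suc x)) where

  data _⋖_ : Fin (suc N) → Fin (suc N) → Set where
    child : ∀ x → suc x ⋖ parent x

  ⋖⇒> : ∀ {i j} → i ⋖ j → depth j < depth i
  ⋖⇒> (child x) = parent-depth x

  ⋖-functional : ∀ {i j k} → i ⋖ j → i ⋖ k → j ≡ k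
  ⋖-functional (child x) (child .x) = refl

  _⋖?_ : ∀ i j → Dec (i ⋖ j)
  zero  ⋖? j = no λ ()
  suc x ⋖? j with parent x Fin.≟ j
  ... | yes refl = yes (child x)
  ... | no ≢j    = no λ { (child .x) → ≢j refl }

  tree : Graph (suc N)
  tree = record
    { Adj    = λ i j → i ⋖ j ⊎ j ⋖ i
    ; sym    = Sum.swap
    ; irrefl = λ { refl (inj₁ i⋖i) → ℕ.<-irrefl refl (⋖⇒> i⋖i)
                 ; refl (inj₂ i⋖i) → ℕ.<-irrefl refl (⋖⇒> i⋖i) }
    ; adj?   = λ i j → (i ⋖? j) ⊎-dec (j ⋖? i)
    }

  open Graph tree using (Adj)
  open Walks tree

  -- After a step to a child the walk can only go on to children: the sole way up leads to the
  -- vertex just left.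
  descend : ∀ {i j p k} → Walk i (j ∷ p) k → j ⋖ i → depth i < depth k
  descend (cons _ _   nil)                          j⋖i = ⋖⇒> j⋖i
  descend (cons _ i≢k (cons (inj₁ j⋖k) _ _))        j⋖i = contradiction (⋖-functional j⋖i j⋖k) i≢k
  descend (cons _ _   w@(cons (inj₂ k⋖j) _ _))      j⋖i = ℕ.<-trans (⋖⇒> j⋖i) (descend w k⋖j)

  -- A step up lowers the depth further; after a step down the rest of the walk descends, by
  -- `descend`.
  stays-above : ∀ {i j k p l} → Walk i (j ∷ k ∷ p) l → depth i < depth l → depth j < depth l
  stays-above (cons (inj₁ i⋖j) _ _) i<l = ℕ.<-trans (⋖⇒> i⋖j) i<l
  stays-above (cons (inj₂ j⋖i) i≢k w@(cons (inj₁ j⋖k) _ _)) _ = contradiction (⋖-functional j⋖i j⋖k) i≢k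
  stays-above (cons (inj₂ j⋖i) _ w@(cons (inj₂ k⋖j) _ _)) _ = descend w k⋖j

  -- `stays-above` carries the depth bound along to the last step, which must therefore go down into
  -- `k`, hence come from its parent. The companion `enters-late` adds that, if the walk has further
  -- vertices before `k`, the parent is met after the start.
  enters-from-parent : ∀ {i k j} p → Walk i (p ∷ʳ k) k → depth i < depth k → k ⋖ j → j ∈ˡ i ∷ p
  enters-late : ∀ {i j k l} p → Walk i (j ∷ p ∷ʳ k) k → depth i < depth k → k ⋖ l → l ∈ˡ j ∷ p

  enters-from-parent []      (cons (inj₁ i⋖k) _ _) i<k _   = contradiction (⋖⇒> i⋖k) (ℕ.<-asym i<k)
  enters-from-parent []      (cons (inj₂ k⋖i) _ _) _   k⋖j = here (⋖-functional k⋖j k⋖i)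
  enters-from-parent (_ ∷ p) w                     i<k k⋖j = there (enters-late p w i<k k⋖j)

  enters-late []        w@(cons _ _ w′) i<k = enters-from-parent [] w′ (stays-above w i<k)
  enters-late p@(_ ∷ _) w@(cons _ _ w′) i<k = enters-from-parent p w′ (stays-above w i<k)

  -- A cycle cannot start downwards, for then it descends forever; so it starts
  -- with the parent of x, and it can only come back to x through that parent.
  acyclic : Acyclic tree
  acyclic x (_ ∷ []) _ (s≤s ())
  acyclic x (y ∷ z ∷ zs) ((x≢y ∷ x≢z ∷ x∉) ∷ u@(y∉ ∷ _)) _ (xy ∷ l)
    with cycle⇒walk (z ∷ zs) l u (All.All¬⇒¬Any (x≢y ∷ x≢z ∷ x∉))
  ... | w with xy
  ...   | inj₁ x⋖y = All.All¬⇒¬Any y∉ (enters-late zs w (⋖⇒> x⋖y) x⋖y)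
  ...   | inj₂ y⋖x = ℕ.<-irrefl refl (descend (cons xy x≢z w) y⋖x)

  -- Any member climbs within `P` to `top`, by induction on depth; two members are connected through
  -- `top`.
  connectedOn : ∀ {P : Fin (suc N) → Set} top → (P zero → zero ≡ top) →
    (∀ x → P (suc x) → suc x ≡ top ⊎ P (parent x)) → ConnectedOn tree P
  connectedOn {P} top root climb Pi Pj =
    toTop (<-wellFounded _) Pi ◅◅ Star.reverse back (toTop (<-wellFounded _) Pj)
    where
    Step : Fin (suc N) → Fin (suc N) → Set
    Step i j = P i × P j × Adj i j
    back : ∀ {i j} → Step i j → Step j i
    back (Pi , Pj , ij) = Pj , Pi , Sum.swap ij
    toTop : ∀ {i} → Acc _<_ (depth i) → P i → Star Step i top
    toTop {zero} _ Pi with root Pi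
    ... | refl = ε
    toTop {suc x} (acc rs) Pi with climb x Pi
    ... | inj₁ refl = ε
    ... | inj₂ Pp   = (Pi , Pp , inj₁ (child x)) ◅ toTop (rs (parent-depth x)) Pp

  isTree : IsTree tree
  isTree = record
    { nonEmpty  = _
    ; connected = λ x y → Star.map (proj₂ ∘ proj₂) (connectedOn {P = λ _ → ⊤} zero (λ _ → refl) (λ _ _ → inj₂ tt) {x} {y} tt tt)
    ; acyclic   = acyclic
    }

-- Coordinates for the edge-nodes

module Spots {N} {G : Graph N} (P : PseudoClique G) where
  open Graph G using (Adj)
  open PseudoClique P

  -- (u , v , i) stands for the i-th edge-node, counted from 0, on the path from u to v.
  Spot : Set
  Spot = ∃₂ λ u v → Fin (length (edgeNodes u v))

  vertex : Spot → Fin N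
  vertex (u , v , i) = lookup (edgeNodes u v) i

  far : Spot → Fin N
  far (_ , v , _) = v

  index : Spot → ℕ
  index (_ , _ , i) = toℕ i

  -- Selects one of the two orientations of each path, so that an edge-node has a single valid spot.
  Ordered : Fin N → Fin N → Set
  Ordered u v = u ∈ main × v ∈ main × u Fin.< v

  Valid : Spot → Set
  Valid (u , v , _) = Ordered u v

  ordered⇒pair : ∀ {u v} → Ordered u v → MainPair u v
  ordered⇒pair (u∈ , v∈ , u<v) = u∈ , v∈ , λ u≡v → Fin.<-irrefl u≡v u<v

  order : ∀ {u v} → MainPair u v → Ordered u v ⊎ Ordered v u
  order {u} {v} (u∈ , v∈ , u≢v) with Fin.<-cmp u v
  ... | tri< u<v _ _ = inj₁ (u∈ , v∈ , u<v)
  ... | tri≈ _ u≡v _ = contradiction u≡v u≢v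
  ... | tri> _ _ v<u = inj₂ (v∈ , u∈ , v<u)

  vertex∉main : ∀ s → Valid s → vertex s ∉ main
  vertex∉main (_ , _ , i) valid = notMain (ordered⇒pair valid) (∈-lookup i)

  -- `disjoint` fixes the pair up to a swap, the order excludes the swap, and `unique` fixes the
  -- position.
  vertex-injective : ∀ {s t} → Valid s → Valid t → vertex s ≡ vertex t → s ≡ t
  vertex-injective {u , v , i} {_ , _ , j} vs vt eq
    with disjoint (ordered⇒pair vs) (ordered⇒pair vt) (∈-lookup i) (subst (_∈ˡ _) (sym eq) (∈-lookup j))
  ... | inj₁ (refl , refl) =
    cong (λ k → u , v , k) (Unique⇒lookup-injective (unique (ordered⇒pair vs)) i j eq)
  ... | inj₂ (refl , refl) = contradiction (proj₂ (proj₂ vt)) (Fin.<-asym (proj₂ (proj₂ vs)))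

  locate : ∀ x → x ∈ main ⊎ (∃ λ s → Valid s × vertex s ≡ x)
  locate x with cover x
  ... | inj₁ x∈main = inj₁ x∈main
  ... | inj₂ (u , v , pair , x∈) with order pair
  ...   | inj₁ u<v = inj₂ ((u , v , Any.index x∈) , u<v , sym (Any.lookup-index x∈))
  ...   | inj₂ v<u = inj₂ ((v , u , Any.index x∈′) , v<u , sym (Any.lookup-index x∈′))
    where
    x∈′ : x ∈ˡ edgeNodes v u
    x∈′ = subst (x ∈ˡ_) (sym (unordered pair)) (Any.reverse⁺ x∈)

  spot : Fin N → Maybe Spot
  spot x = Sum.[ (λ _ → nothing) , just ∘ proj₁ ] (locate x)

  -- Keeps the proofs that `spot` discards, so that functions defined by cases on `spot x` compute
  -- while these facts are at hand.
  data Located (x : Fin N) : Maybe Spot → Set where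
    atMain : x ∈ main → Located x nothing
    atSpot : ∀ {s} → Valid s → vertex s ≡ x → Located x (just s)

  located : ∀ x → Located x (spot x)
  located x with locate x
  ... | inj₁ x∈main           = atMain x∈main
  ... | inj₂ (_ , valid , eq) = atSpot valid eq

  spot-vertex : ∀ s → Valid s → spot (vertex s) ≡ just s
  spot-vertex s valid with spot (vertex s) | located (vertex s)
  ... | _ | atMain ∈main     = contradiction ∈main (vertex∉main s valid)
  ... | _ | atSpot valid′ eq = cong just (vertex-injective valid′ valid eq)

  spot-main : ∀ {x} → x ∈ main → spot x ≡ nothing
  spot-main {x} x∈main with spot x | located x
  ... | _ | atMain _          = refl
  ... | _ | atSpot {s} valid refl = contradiction x∈main (vertex∉main s valid)

  ordered-edge : ∀ {x y} → Adj x y →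
    ∃₂ λ u v → Ordered u v × (Consecutive x y (path u v) ⊎ Consecutive y x (path u v))
  ordered-edge {x} {y} xy with Equivalence.to (edges x y) xy
  ... | u , v , pair , c with order pair
  ...   | inj₁ u<v = u , v , u<v , inj₁ c
  ...   | inj₂ v<u = v , u , v<u , inj₂ (subst (Consecutive y x) reverse-path (consecutive-ʳ++ [] c))
    where
    reverse-path : reverse (path u v) ≡ path v u
    reverse-path = trans (unfold-reverse u (edgeNodes u v ∷ʳ v))
      (trans (cong (_∷ʳ u) (reverse-++ (edgeNodes u v) (v ∷ [])))
             (cong (λ ys → v ∷ ys ∷ʳ u) (sym (unordered pair))))

  -- For `u` below `v`, these are the vertices of the path that belong to the branch of `u`.
  nearPath : ∀ u v → Fin (suc (length (edgeNodes u v))) → Fin N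
  nearPath u v = lookup (u ∷ edgeNodes u v)

  near-adj : ∀ {u v} → Ordered u v → ∀ i → Adj (nearPath u v (inject₁ i)) (nearPath u v (suc i))
  near-adj o i = Equivalence.from (edges _ _) (_ , _ , ordered⇒pair o , consecutive-inner _ i)

  last-adj : ∀ {u v} → Ordered u v → Adj (nearPath u v (fromℕ _)) v
  last-adj {u} {v} o =
    Equivalence.from (edges _ _) (_ , _ , ordered⇒pair o , consecutive-last (edgeNodes u v))

-- The lower bound: branches and their traces

module LowerBound {N} {G : Graph N} (P : PseudoClique G) (D : TreeDecomposition G) where
  open Graph G using (Adj) renaming (sym to adj-sym)
  open PseudoClique P
  open Spots P
  open TreeDecomposition D
  open Walks tree using (helly; connected⇒convex)

  -- The fibres over the main-nodes are the branches; by the default value a main-node lies in its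
  -- own branch.
  owner : Fin N → Fin N
  owner x = maybe proj₁ x (spot x)

  owner-main : ∀ {u} → u ∈ main → owner u ≡ u
  owner-main u∈ rewrite spot-main u∈ = refl

  owner-nearPath : ∀ {u v} → Ordered u v → ∀ i → owner (nearPath u v i) ≡ u
  owner-nearPath (u∈ , _) zero = owner-main u∈
  owner-nearPath o (suc i) rewrite spot-vertex (_ , _ , i) o = refl

  Branch : Fin N → Fin N → Fin N → Set
  Branch u x y = owner x ≡ u × owner y ≡ u × Adj x y

  -- From an edge-node, follow its path backwards to `u`; all vertices met lie in the branch of `u`.
  toOwner : ∀ x → Star (Branch (owner x)) x (owner x)
  toOwner x with spot x | located x
  ... | _ | atMain _ = ε
  ... | _ | atSpot {u , v , i} o refl = <-weakInduction (λ k → Star (Branch u) (nearPath u v k) u) ε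
    (λ k s → (owner-nearPath o (suc k) , owner-nearPath o (inject₁ k) , adj-sym (near-adj o k)) ◅ s)
    (suc i)

  Trace : Fin N → Fin nodes → Set
  Trace u t = ∃ λ x → owner x ≡ u × x ∈ bag t

  -- Follow the branch from `x` to `y`. The bags with a given vertex are connected by `coherent`,
  -- and a bag that covers an edge of the branch links those of its two ends.
  trace-connected : ∀ u → ConnectedOn tree (Trace u)
  trace-connected u {s} {t} (x , refl , x∈s) (y , y∈u , y∈t) =
    follow (toOwner x ◅◅ Star.reverse (λ (a , b , ab) → b , a , adj-sym ab)
                           (subst (λ w → Star (Branch w) y w) y∈u (toOwner y)))
           refl x∈s y∈t
    where
    within : ∀ {x s t} → owner x ≡ u → x ∈ bag s → x ∈ bag t →
      Star (λ a b → Trace u a × Trace u b × Graph.Adj tree a b) s t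
    within {x} x∈u x∈s x∈t =
      Star.map (λ (a , b , ab) → (x , x∈u , a) , (x , x∈u , b) , ab) (coherent x x∈s x∈t)
    follow : ∀ {x y s t} → Star (Branch u) x y → owner x ≡ u → x ∈ bag s → y ∈ bag t →
      Star (λ a b → Trace u a × Trace u b × Graph.Adj tree a b) s t
    follow ε x∈u x∈s x∈t = within x∈u x∈s x∈t
    follow ((_ , z∈u , xz) ◅ p) x∈u x∈s y∈t with coverEdge xz
    ... | r , x∈r , z∈r = within x∈u x∈s x∈r ◅◅ follow p z∈u z∈r y∈t

  -- The last edge of the path leads from the branch of `u` to `v` itself, and some bag covers it.
  ordered-meet : ∀ {u v} → Ordered u v → ∃ λ t → Trace u t × Trace v t
  ordered-meet o@(_ , v∈ , _) with coverEdge (last-adj o)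
  ... | t , x∈t , v∈t = t , (_ , owner-nearPath o (fromℕ _) , x∈t) , (_ , owner-main v∈ , v∈t)

  traces-meet : ∀ {u v} → u ∈ main → v ∈ main → ∃ λ t → Trace u t × Trace v t
  traces-meet {u} {v} u∈ v∈ with u Fin.≟ v
  ... | yes refl with coverVertex u
  ...   | t , u∈t = t , (u , owner-main u∈ , u∈t) , (u , owner-main u∈ , u∈t)
  traces-meet {u} {v} u∈ v∈ | no u≢v with order (u∈ , v∈ , u≢v)
  ... | inj₁ u<v = ordered-meet u<v
  ... | inj₂ v<u = map₂ (λ (a , b) → b , a) (ordered-meet v<u)

  -- At a node common to all traces the bag contains a vertex of every branch. So its image under
  -- `owner` includes `main`, and an image is no larger than the set.
  large-bag : ∀ {u} → u ∈ main → ∃ λ t → size ≤ ∣ bag t ∣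
  large-bag {u₀} u₀∈ = t , ℕ.≤-trans (p⊆q⇒∣p∣≤∣q∣ main⊆) (∣image∣≤ owner (bag t))
    where
    -- `helly` takes a list of main-nodes with their membership proofs. Sending all other vertices
    -- to `u₀` extracts such a list from `allFin N`.
    rep : Fin N → ∃ (_∈ main)
    rep u with u ∈? main
    ... | yes u∈ = u , u∈
    ... | no _   = u₀ , u₀∈
    common : ∃ λ t → Trace u₀ t × All (λ i → Trace (proj₁ i) t) (map rep (allFin N))
    common = helly (IsTree.acyclic isTree) (IsTree.connected isTree) (Trace ∘ proj₁)
      (λ i → connected⇒convex (IsTree.acyclic isTree) (trace-connected (proj₁ i)))
      (λ i j → traces-meet (proj₂ i) (proj₂ j)) (u₀ , u₀∈) (map rep (allFin N))
    t : Fin nodes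
    t = proj₁ common
    main⊆ : main ⊆ image owner (bag t)
    main⊆ {u} u∈ with u ∈? main | All.lookup (All.map⁻ (proj₂ (proj₂ common))) (∈-allFin u)
    ... | yes _ | x , refl , x∈t = ∈-image owner x∈t
    ... | no u∉ | _              = contradiction u∈ u∉

  size∸1≤width : ∀ {u} → u ∈ main → size ∸ 1 ≤ width D
  size∸1≤width u∈ with large-bag u∈
  ... | t , size≤ = ℕ.∸-monoˡ-≤ 1 (ℕ.≤-trans size≤
    (All.lookup (xs≤max 0 (map (λ i → ∣ bag i ∣) (allFin nodes))) (∈-map⁺ (λ i → ∣ bag i ∣) (∈-allFin t))))

-- The upper bound: a centre with chains of small bags

-- Node zero is the centre.  Node suc x, for x = v_i on the path u , v₁ , … , v_m , v with
-- u < v, has bag {v_{i-1} , v_i , v} (where v₀ = u).  For a main-node x, node suc x is a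
-- leaf with empty bag, present only to keep the node set uniform.
module UpperBound {N} {G : Graph N} (P : PseudoClique G) where
  open Graph G using (Adj)
  open PseudoClique P
  open Spots P

  pred : ∀ {m} → Fin m → Maybe (Fin m)
  pred zero    = nothing
  pred (suc i) = just (inject₁ i)

  back : Spot → Maybe Spot
  back (u , v , i) = Maybe.map (λ j → u , v , j) (pred i)

  data Back (s : Spot) : Maybe Spot → Set where
    first : Back s nothing
    later : ∀ {t} → Valid t → far t ≡ far s → index t < index s → Back s (just t)

  backView : ∀ s → Valid s → Back s (back s)
  backView (u , v , i) valid with pred i | pred-< i
    where
    pred-< : ∀ {m} (i : Fin m) → maybe (λ j → toℕ j < toℕ i) ⊤ (pred i)
    pred-< zero    = tt
    pred-< (suc i) = s≤s (ℕ.≤-reflexive (Fin.toℕ-inject₁ i))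
  ... | nothing | _   = first
  ... | just j  | j<i = later valid refl j<i

  -- The default value is the starting point `u` of the path, which precedes its first edge-node.
  prev : Spot → Fin N
  prev s = maybe vertex (proj₁ s) (back s)

  prev-nearPath : ∀ u v i → prev (u , v , i) ≡ nearPath u v (inject₁ i)
  prev-nearPath u v i with pred i | lookup-pred (edgeNodes u v) i
    where
    lookup-pred : ∀ ys (i : Fin (length ys)) → maybe (lookup ys) u (pred i) ≡ lookup (u ∷ ys) (inject₁ i)
    lookup-pred (_ ∷ _) zero    = refl
    lookup-pred (_ ∷ _) (suc _) = refl
  ... | nothing | eq = eq
  ... | just _  | eq = eq

  parentOf : Maybe Spot → Fin (suc N)
  parentOf nothing  = zero
  parentOf (just s) = maybe (suc ∘ vertex) zero (back s)

  -- Distance from the centre. The default 1 is for the leaves of main-nodes, which hang directly on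
  -- it.
  depthOf : Maybe Spot → ℕ
  depthOf = maybe (suc ∘ index) 1

  parent : Fin N → Fin (suc N)
  parent x = parentOf (spot x)

  depth : Fin (suc N) → ℕ
  depth zero    = 0
  depth (suc x) = depthOf (spot x)

  parent-depth : ∀ x → depth (parent x) < depth (suc x)
  parent-depth x with spot x | located x
  ... | _ | atMain _ = s≤s z≤n
  ... | _ | atSpot {s} valid _ with back s | backView s valid
  ...   | _ | first = s≤s z≤n
  ...   | _ | later {t} valid′ _ t<s rewrite spot-vertex t valid′ = s≤s t<s

  open Rooted parent depth parent-depth

  bagOf : Maybe Spot → Subset N
  bagOf nothing  = ⊥
  bagOf (just s) = ⁅ vertex s ⁆ ∪ (⁅ prev s ⁆ ∪ ⁅ far s ⁆)

  bag : Fin (suc N) → Subset N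
  bag zero    = main
  bag (suc x) = bagOf (spot x)

  data InBag (s : Spot) (z : Fin N) : Set where
    isVertex : z ≡ vertex s → InBag s z
    isPrev   : z ≡ prev s   → InBag s z
    isFar    : z ≡ far s    → InBag s z

  inBag⁻ : ∀ {s z} → z ∈ bagOf (just s) → InBag s z
  inBag⁻ {s} z∈ with x∈p∪q⁻ ⁅ vertex s ⁆ _ z∈
  ... | inj₁ z∈v = isVertex (x∈⁅y⁆⇒x≡y _ z∈v)
  ... | inj₂ z∈pf with x∈p∪q⁻ ⁅ prev s ⁆ _ z∈pf
  ...   | inj₁ z∈p = isPrev (x∈⁅y⁆⇒x≡y _ z∈p)
  ...   | inj₂ z∈f = isFar (x∈⁅y⁆⇒x≡y _ z∈f)

  inBag⁺ : ∀ {s z} → InBag s z → z ∈ bagOf (just s)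
  inBag⁺ (isVertex refl) = x∈p∪q⁺ (inj₁ (x∈⁅x⁆ _))
  inBag⁺ (isPrev refl)   = x∈p∪q⁺ (inj₂ (x∈p∪q⁺ (inj₁ (x∈⁅x⁆ _))))
  inBag⁺ (isFar refl)    = x∈p∪q⁺ (inj₂ (x∈p∪q⁺ (inj₂ (x∈⁅x⁆ _))))

  ∈-bag : ∀ s {z} → Valid s → InBag s z → z ∈ bag (suc (vertex s))
  ∈-bag s valid z∈ = subst (λ m → _ ∈ bagOf m) (sym (spot-vertex s valid)) (inBag⁺ z∈)

  -- Going away from the centre, a bag gains only its own edge-node. Its `prev` is the own vertex of
  -- the parent's bag, or a main-node if the parent is the centre; its `far` end is kept along the
  -- chain and lies in the centre.
  climb : ∀ {z} x → z ∈ bag (suc x) → (x ≡ z × z ∉ main) ⊎ z ∈ bag (parent x)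
  climb x z∈ with spot x | located x
  ... | _ | atMain _ = contradiction z∈ ∉⊥
  ... | _ | atSpot {s} valid refl with inBag⁻ z∈
  ...   | isVertex refl = inj₁ (refl , vertex∉main s valid)
  ...   | isPrev refl with back s | backView s valid
  ...     | _ | first                 = inj₂ (proj₁ valid)
  ...     | _ | later {t} valid′ _ _ = inj₂ (∈-bag t valid′ (isVertex refl))
  climb x z∈ | _ | atSpot {s} valid refl | isFar refl with back s | backView s valid
  ...     | _ | first                  = inj₂ (proj₁ (proj₂ valid))
  ...     | _ | later {t} valid′ eq _ = inj₂ (∈-bag t valid′ (isFar (sym eq)))

  -- The highest bag with `z` is the centre for a main-node and `suc z` for an edge-node.
  coherent : ∀ z → ConnectedOn tree (λ i → z ∈ bag i)
  coherent z with z ∈? main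
  ... | yes z∈main = connectedOn zero (λ _ → refl) λ x z∈ →
          Sum.map₁ (λ (_ , z∉main) → contradiction z∈main z∉main) (climb x z∈)
  ... | no z∉main = connectedOn (suc z) (λ z∈main → contradiction z∈main z∉main) λ x z∈ →
          Sum.map₁ (λ (x≡z , _) → cong suc x≡z) (climb x z∈)

  coverVertex : ∀ x → ∃ λ i → x ∈ bag i
  coverVertex x with locate x
  ... | inj₁ x∈main             = zero , x∈main
  ... | inj₂ (s , valid , refl) = suc (vertex s) , ∈-bag s valid (isVertex refl)

  coverConsecutive : ∀ {u v x y} → Ordered u v → Consecutive x y (path u v) →
    ∃ λ i → x ∈ bag i × y ∈ bag i
  coverConsecutive {u} {v} o c with consecutive⁻ (edgeNodes u v) c
  ... | inj₁ (i , x≡ , refl) =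
    suc (vertex (u , v , i)) ,
    ∈-bag (u , v , i) o (isPrev (trans x≡ (sym (prev-nearPath u v i)))) ,
    ∈-bag (u , v , i) o (isVertex refl)
  -- Here the edge joins `u` directly to `v`, so the centre covers it.
  ... | inj₂ (zero , refl , refl)  = zero , proj₁ o , proj₁ (proj₂ o)
  ... | inj₂ (suc i , refl , refl) =
    suc (vertex (u , v , i)) , ∈-bag (u , v , i) o (isVertex refl) , ∈-bag (u , v , i) o (isFar refl)

  coverEdge : ∀ {x y} → Adj x y → ∃ λ i → x ∈ bag i × y ∈ bag i
  coverEdge xy with ordered-edge xy
  ... | _ , _ , o , inj₁ c = coverConsecutive o c
  ... | _ , _ , o , inj₂ c = map₂ (λ (a , b) → b , a) (coverConsecutive o c)

  decomposition : TreeDecomposition G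
  decomposition = record
    { tree        = tree
    ; isTree      = isTree
    ; bag         = bag
    ; coverVertex = coverVertex
    ; coverEdge   = coverEdge
    ; coherent    = coherent
    }

  ∣bagOf∣≤3 : ∀ m → ∣ bagOf m ∣ ≤ 3
  ∣bagOf∣≤3 nothing  = ℕ.≤-trans (ℕ.≤-reflexive (∣⊥∣≡0 N)) z≤n
  ∣bagOf∣≤3 (just s) = ℕ.≤-trans (∣p∪q∣≤∣p∣+∣q∣ ⁅ vertex s ⁆ _)
    (ℕ.+-mono-≤ (singleton (vertex s)) (ℕ.≤-trans (∣p∪q∣≤∣p∣+∣q∣ ⁅ prev s ⁆ ⁅ far s ⁆)
      (ℕ.+-mono-≤ (singleton (prev s)) (singleton (far s)))))
    where
    singleton : ∀ (x : Fin N) → ∣ ⁅ x ⁆ ∣ ≤ 1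
    singleton x = ℕ.≤-reflexive (∣⁅x⁆∣≡1 x)

  -- The hypothesis makes room for the chain bags, which may have three elements; the central bag is
  -- `main` itself.
  width≤size∸1 : 3 ≤ size → width decomposition ≤ size ∸ 1
  width≤size∸1 3≤size = ℕ.∸-monoˡ-≤ 1
    (max≤v⁺ z≤n (All.map⁺ (All.tabulate {xs = allFin (suc N)} λ {i} _ → ∣bag∣≤size i)))
    where
    ∣bag∣≤size : ∀ i → ∣ bag i ∣ ≤ size
    ∣bag∣≤size zero    = ℕ.≤-refl
    ∣bag∣≤size (suc x) = ℕ.≤-trans (∣bagOf∣≤3 (spot x)) 3≤size

-- Combination of the two bounds

∣p∣>0⇒nonempty : ∀ {n} (p : Subset n) → 0 < ∣ p ∣ → ∃ (_∈ p)
∣p∣>0⇒nonempty (inside ∷ p)  _   = zero , Vec.here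
∣p∣>0⇒nonempty (outside ∷ p) 0<p with ∣p∣>0⇒nonempty p 0<p
... | x , x∈p = suc x , Vec.there x∈p

theorem8 : ∀ {N : ℕ} (G : Graph N) (P : PseudoClique G) (n k : ℕ) →
    PseudoClique.size P ≡ n → PseudoClique.IsCardinality P k →
    n ≥ 3 → IsTreewidth G (n ∸ 1)
theorem8 G P _ _ refl _ n≥3 = record
  { attained = decomposition , ℕ.≤-antisym (width≤size∸1 n≥3) (lower decomposition)
  ; minimal  = lower
  }
  where
  open UpperBound P using (decomposition; width≤size∸1)
  lower : ∀ D → PseudoClique.size P ∸ 1 ≤ width D
  lower D = LowerBound.size∸1≤width P D
    -- The Helly argument starts from some main-node, which exists because the size is positive.
    (proj₂ (∣p∣>0⇒nonempty (PseudoClique.main P) (ℕ.≤-trans (s≤s z≤n) n≥3)))
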